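{- Let $n,m\ge 0$ be integers with $2n+m\ge 1$ and $(n,m)\neq(0,1)$. For every pair of integers $k\ge 2$ and $r\ge 2$ there exists an $(n,m)$-graph $G_k$ such that $\mathrm{arb}(\mathrm{und}(G_k))\le r$ and $\chi_{n,m}(G_k)\ge k$.
   Context: All graphs are finite. An $(n,m)$-graph $G$ is a graph with $n$ types of arcs (labeled $2,4,\ldots,2n$) and $m$ types of edges (labeled $2n+1,\ldots,2n+m$), whose underlying undirected graph $\mathrm{und}(G)$ is simple (so each adjacent pair of distinct vertices is joined by exactly one arc or exactly one edge, with exactly one type, and there are no loops). A homomorphism of an $(n,m)$-graph $G$ to an $(n,m)$-graph $H$ is a map $f:V(G)\to V(H)$ such that whenever $uv$ is an arc from $u$ to $v$ (resp. an edge) of type $\alpha$ in $G$, $f(u)f(v)$ is an arc from $f(u)$ to $f(v)$ (resp. an edge) of type $\alpha$ in $H$; write $G\to H$ if one exists. For an $(n,m)$-graph $G$, $\chi_{n,m}(G)=\min\{|V(H)|: H \text{ an } (n,m)\text{ -graph},\ G\to H\}$. The arboricity $\mathrm{arb}(G)$ of a graph $G$ is the minimum $r$ such that the edge set of $G$ can be decomposed into $r$ forests. -}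

module Defs where

open import Data.Bool.Base using (Bool; false; T)
open import Data.Fin.Base using (Fin; zero; suc; inject₁; fromℕ)
open import Data.Maybe.Base using (Maybe; just; nothing; is-just; map)
open import Data.Nat.Base using (ℕ; _+_; _≤_)
open import Data.Product.Base using (Σ-syntax; ∃-syntax; _×_)
open import Function.Definitions using (Injective)
open import Relation.Binary.PropositionalEquality using (_≡_; refl; cong)
open import Relation.Nullary.Negation using (¬_)

-- "c = min { d : P d }".
record IsMinimum (P : ℕ → Set) (c : ℕ) : Set where
  field
    attained : P c
    least    : ∀ d → P d → c ≤ d

record SimpleGraph (N : ℕ) : Set where
  field
    adj    : Fin N → Fin N → Bool
    symm   : ∀ u v → adj u v ≡ adj v u
    irrefl : ∀ u → adj u u ≡ false

  Adj : Fin N → Fin N → Set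
  Adj u v = T (adj u v)

-- A cycle visits at least three vertices, all distinct; `closing` joins the
-- last one to the first.
record Cycle {N : ℕ} (G : SimpleGraph N) : Set where
  open SimpleGraph G
  field
    {excess} : ℕ
    vertex   : Fin (3 + excess) → Fin N
    distinct : Injective _≡_ _≡_ vertex
    step     : ∀ (i : Fin (2 + excess)) → Adj (vertex (inject₁ i)) (vertex (suc i))
    closing  : Adj (vertex (fromℕ (2 + excess))) (vertex zero)

IsForest : ∀ {N} → SimpleGraph N → Set
IsForest G = ¬ Cycle G

-- A partition of the edge set of G into r (possibly empty) edge sets, each of
-- which forms a forest on the vertex set of G.
record ForestDecomposition {N : ℕ} (G : SimpleGraph N) (r : ℕ) : Set where
  open SimpleGraph
  field
    part     : Fin r → SimpleGraph N
    forest   : ∀ i → IsForest (part i)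
    within   : ∀ i {u v} → Adj (part i) u v → Adj G u v
    covers   : ∀ {u v} → Adj G u v → ∃[ i ] Adj (part i) u v
    disjoint : ∀ {i j u v} → Adj (part i) u v → Adj (part j) u v → i ≡ j

IsArboricity : ∀ {N} → SimpleGraph N → ℕ → Set
IsArboricity G = IsMinimum (ForestDecomposition G)

-- How a vertex u is joined to a vertex v: by an arc u → v, by an arc v → u, or
-- by an edge, each with its type.
data Link (n m : ℕ) : Set where
  arcTo   : Fin n → Link n m
  arcFrom : Fin n → Link n m
  edge    : Fin m → Link n m

reverse : ∀ {n m} → Link n m → Link n m
reverse (arcTo α)   = arcFrom α
reverse (arcFrom α) = arcTo α
reverse (edge α)    = edge α

-- Since `link` assigns at most one link to a pair of vertices, and `link v u`
-- is determined by `link u v`, the underlying graph has no parallel edges.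
record Graph (n m : ℕ) : Set where
  field
    order     : ℕ
    link      : Fin order → Fin order → Maybe (Link n m)
    link-symm : ∀ u v → link v u ≡ map reverse (link u v)
    loopless  : ∀ u → link u u ≡ nothing

  Vertex : Set
  Vertex = Fin order

  Arc : Fin n → Vertex → Vertex → Set
  Arc α u v = link u v ≡ just (arcTo α)

  Edge : Fin m → Vertex → Vertex → Set
  Edge α u v = link u v ≡ just (edge α)

und : ∀ {n m} (G : Graph n m) → SimpleGraph (Graph.order G)
und G = record
  { adj    = λ u v → is-just (link u v)
  ; symm   = symm
  ; irrefl = λ u → cong is-just (loopless u)
  }
  where
  open Graph G
  symm : ∀ u v → is-just (link u v) ≡ is-just (link v u)
  symm u v rewrite link-symm u v with link u v
  ... | just _  = refl
  ... | nothing = refl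

record Hom {n m : ℕ} (G H : Graph n m) : Set where
  open Graph
  field
    map-vertex : Vertex G → Vertex H
    map-arc    : ∀ {α u v} → Arc G α u v → Arc H α (map-vertex u) (map-vertex v)
    map-edge   : ∀ {α u v} → Edge G α u v → Edge H α (map-vertex u) (map-vertex v)

IsChromaticNumber : ∀ {n m} → Graph n m → ℕ → Set
IsChromaticNumber {n} {m} G =
  IsMinimum (λ c → Σ[ H ∈ Graph n m ] (Graph.order H ≡ c × Hom G H))

{-# OPTIONS --safe #-}

-- Join each ordered pair (x , y) of k ≥ 2 branch vertices by a path of length
-- two whose middle vertex sees x and y through different links. A homomorphism
-- cannot identify the two ends of such a path, so it is injective on the branch
-- vertices. The halves of the paths at the first ends form a disjoint union of
-- stars, as do the halves at the second ends, while the middle vertices (0 , 1)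
-- and (1 , 0) yield a 4-cycle; hence the arboricity is exactly 2.
-- The chromatic number exists constructively because homomorphisms to graphs of
-- order c correspond to maps into Fin c satisfying a decidable condition.
module Submission where

open import Data.Bool.Base using (T)
open import Data.Bool.Properties using (T?)
open import Data.Fin using (#_)
open import Data.Fin.Base using (Fin; zero; suc; finToFun; funToFin)
open import Data.Fin.Properties
  using (_≟_; any?; all?; +↔⊎; *↔×; finToFun-funToFin; injective⇒≤)
open import Data.Maybe.Base using (Maybe; just; nothing; map; is-just)
open import Data.Maybe.Properties using (≡-dec; just-injective)
open import Data.Nat.Base using (ℕ; zero; suc; z≤n; s≤s; _+_; _*_; _≤_; _<_)
open import Data.Nat.Induction using (<-rec)
open import Data.Nat.Properties using (anyUpTo?; ≮⇒≥)
open import Data.Product.Base using (Σ-syntax; ∃; ∃-syntax; ∃₂; _×_; _,_)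
open import Data.Sum.Base using (_⊎_; inj₁; inj₂)
open import Data.Sum.Function.Propositional using (_⊎-↔_)
open import Function.Base using (_∘_)
open import Function.Bundles using (_↔_; module Inverse)
open import Function.Definitions using (Injective)
open import Function.Properties.Inverse using (↔-refl; ↔-trans)
open import Relation.Binary.Definitions using (DecidableEquality)
open import Relation.Binary.PropositionalEquality
  using (_≡_; _≢_; _≗_; refl; sym; trans; cong; cong₂; subst; subst₂)
open import Relation.Nullary.Decidable
  using (Dec; yes; no; isYes; map′; _×-dec_; _→-dec_; ¬?; toWitness; fromWitness)
open import Relation.Nullary.Negation using (contradiction)
open import Relation.Unary using (Decidable)
open import Defs

-- Minima of decidable predicates

minimum : ∀ {P : ℕ → Set} → Decidable P → ∀ c → P c → ∃ (IsMinimum P)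
minimum {P} P? = <-rec _ descend
  where
  descend : ∀ c → (∀ {d} → d < c → P d → ∃ (IsMinimum P)) → P c → ∃ (IsMinimum P)
  -- A witness below `c` restarts the descent from there; if there is none, `c` itself is least.
  descend c rec pc with anyUpTo? P? c
  ... | yes (d , d<c , pd) = rec d<c pd
  ... | no none = c , record
    { attained = pc
    ; least    = λ d pd → ≮⇒≥ λ d<c → none (d , d<c , pd)
    }

-- Forests, leaves and cycles

module _ {N : ℕ} (G : SimpleGraph N) where
  open SimpleGraph G

  Leaf : Fin N → Set
  Leaf u = ∀ x y → Adj u x → Adj u y → x ≡ y

  Adj-sym : ∀ {u v} → Adj u v → Adj v u
  Adj-sym {u} {v} = subst T (symm u v)

  -- Of the first two vertices of a cycle, one would be a leaf with two
  -- distinct neighbours.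
  leaf-edges⇒forest : (∀ u v → Adj u v → Leaf u ⊎ Leaf v) → IsForest G
  leaf-edges⇒forest leafEnd C with leafEnd _ _ (Cycle.step C zero)
  ... | inj₁ leaf₀ with Cycle.distinct C
                          (leaf₀ _ _ (Cycle.step C zero) (Adj-sym (Cycle.closing C)))
  ...   | ()
  leaf-edges⇒forest leafEnd C | inj₂ leaf₁
    with Cycle.distinct C
           (leaf₁ _ _ (Adj-sym (Cycle.step C zero)) (Cycle.step C (suc zero)))
  ...   | ()

  -- With no parts the closing edge is uncovered; with a single part, that part contains every edge
  -- and hence the whole cycle.
  cycle⇒2≤forests : Cycle G → ∀ d → ForestDecomposition G d → 2 ≤ d
  cycle⇒2≤forests C zero D with ForestDecomposition.covers D (Cycle.closing C)
  ... | () , _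
  cycle⇒2≤forests C (suc zero) D = contradiction C′ (forest zero)
    where
    open ForestDecomposition D
    covered : ∀ {u v} → Adj u v → SimpleGraph.Adj (part zero) u v
    covered e with covers e
    ... | zero , e′ = e′
    C′ : Cycle (part zero)
    C′ = record
      { vertex   = Cycle.vertex C
      ; distinct = Cycle.distinct C
      ; step     = λ i → covered (Cycle.step C i)
      ; closing  = covered (Cycle.closing C)
      }
  cycle⇒2≤forests C (suc (suc d)) D = s≤s (s≤s z≤n)

-- Homomorphisms and the chromatic number

module _ {n m : ℕ} where

  _≟ᴸ_ : DecidableEquality (Link n m)
  arcTo α   ≟ᴸ arcTo β   = map′ (cong arcTo) (λ { refl → refl }) (α ≟ β)
  arcFrom α ≟ᴸ arcFrom β = map′ (cong arcFrom) (λ { refl → refl }) (α ≟ β)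
  edge α    ≟ᴸ edge β    = map′ (cong edge) (λ { refl → refl }) (α ≟ β)
  arcTo _   ≟ᴸ arcFrom _ = no λ ()
  arcTo _   ≟ᴸ edge _    = no λ ()
  arcFrom _ ≟ᴸ arcTo _   = no λ ()
  arcFrom _ ≟ᴸ edge _    = no λ ()
  edge _    ≟ᴸ arcTo _   = no λ ()
  edge _    ≟ᴸ arcFrom _ = no λ ()

  -- A backward arc is a forward arc of the reversed pair, so symmetry of links on both sides
  -- reduces it to `map-arc`.
  map-link : ∀ {G H : Graph n m} (f : Hom G H) {u v l} → Graph.link G u v ≡ just l →
             Graph.link H (Hom.map-vertex f u) (Hom.map-vertex f v) ≡ just l
  map-link f {l = arcTo α} uv = Hom.map-arc f uv
  map-link {G} {H} f {u} {v} {arcFrom α} uv =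
    trans (Graph.link-symm H _ _)
          (cong (map reverse)
            (Hom.map-arc f (trans (Graph.link-symm G u v) (cong (map reverse) uv))))
  map-link f {l = edge α} uv = Hom.map-edge f uv

  module _ (G : Graph n m) where
    open Graph G
    open SimpleGraph (und G) using (Adj)

    -- Exactly what lets the links of `G` descend along `f` to a graph on `Fin c`. The target graph
    -- is not mentioned, so the condition is a finite check.
    record Compatible {c : ℕ} (f : Vertex → Fin c) : Set where
      field
        proper     : ∀ u v → Adj u v → f u ≢ f v
        consistent : ∀ u v u′ v′ → Adj u v → Adj u′ v′ →
                     f u ≡ f u′ → f v ≡ f v′ → link u v ≡ link u′ v′

    compatible? : ∀ {c} (f : Vertex → Fin c) → Dec (Compatible f)
    compatible? f = map′
      (λ (p , q) → record { proper = p ; consistent = q })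
      (λ f-compatible → Compatible.proper f-compatible , Compatible.consistent f-compatible)
      (all? (λ u → all? λ v → T? _ →-dec ¬? (f u ≟ f v))
       ×-dec
       all? (λ u → all? λ v → all? λ u′ → all? λ v′ →
         T? _ →-dec T? _ →-dec f u ≟ f u′ →-dec f v ≟ f v′ →-dec
         ≡-dec _≟ᴸ_ (link u v) (link u′ v′)))

    -- Decoding the code of a map returns it only up to pointwise equality, so compatibility has to
    -- be transported along `≗`.
    compatible-resp-≗ : ∀ {c} {f g : Vertex → Fin c} → f ≗ g → Compatible f → Compatible g
    compatible-resp-≗ {f = f} {g} f≗g f-compatible = record
      { proper     = λ u v e gu≡gv → proper u v e (back u v gu≡gv)
      ; consistent = λ u v u′ v′ e e′ p q →
          consistent u v u′ v′ e e′ (back u u′ p) (back v v′ q)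
      }
      where
      open Compatible f-compatible
      back : ∀ u v → g u ≡ g v → f u ≡ f v
      back u v gu≡gv = trans (f≗g u) (trans gu≡gv (sym (f≗g v)))

    -- Adjacent vertices with one image would put a loop in `H`; two linked pairs with the same
    -- image both carry the link of that image.
    hom⇒compatible : ∀ {H} (f : Hom G H) → Compatible (Hom.map-vertex f)
    hom⇒compatible {H} f = record { proper = proper ; consistent = consistent }
      where
      open Hom f
      proper : ∀ u v → Adj u v → map-vertex u ≢ map-vertex v
      proper u v e fu≡fv with link u v in uv
      ... | just l
        with trans (sym (map-link f uv))
                   (trans (cong (Graph.link H _) (sym fu≡fv)) (Graph.loopless H _))
      ...   | ()
      consistent : ∀ u v u′ v′ → Adj u v → Adj u′ v′ →
                   map-vertex u ≡ map-vertex u′ → map-vertex v ≡ map-vertex v′ →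
                   link u v ≡ link u′ v′
      consistent u v u′ v′ e e′ p q with link u v in uv | link u′ v′ in uv′
      ... | just l | just l′ =
        trans (sym (map-link f uv)) (trans (cong₂ (Graph.link H) p q) (map-link f uv′))

    module Image {c : ℕ} (f : Vertex → Fin c) (f-compatible : Compatible f) where
      open Compatible f-compatible

      Preimage : Fin c → Fin c → Set
      Preimage a b = ∃₂ λ u v → f u ≡ a × f v ≡ b × Adj u v

      preimage? : ∀ a b → Dec (Preimage a b)
      preimage? a b = any? λ u → any? λ v → f u ≟ a ×-dec f v ≟ b ×-dec T? _

      -- The link is read off whichever preimage the search finds; `consistent` makes the choice
      -- immaterial.
      imageLink : Fin c → Fin c → Maybe (Link n m)
      imageLink a b with preimage? a b
      ... | yes (u , v , _) = link u v
      ... | no _            = nothing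

      imageLink-symm : ∀ a b → imageLink b a ≡ map reverse (imageLink a b)
      imageLink-symm a b with preimage? a b | preimage? b a
      ... | yes (u , v , p , q , e) | yes (v′ , u′ , q′ , p′ , e′) =
        trans (consistent v′ u′ v u e′ (Adj-sym (und G) e) (trans q′ (sym q)) (trans p′ (sym p)))
              (link-symm u v)
      ... | yes (u , v , p , q , e) | no ∄ =
        contradiction (v , u , q , p , Adj-sym (und G) e) ∄
      ... | no ∄ | yes (v , u , q , p , e) =
        contradiction (u , v , p , q , Adj-sym (und G) e) ∄
      ... | no _ | no _ = refl

      imageLink-loopless : ∀ a → imageLink a a ≡ nothing
      imageLink-loopless a with preimage? a a
      ... | yes (u , v , p , q , e) = contradiction (trans p (sym q)) (proper u v e)
      ... | no _                    = refl

      image : Graph n m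
      image = record
        { order     = c
        ; link      = imageLink
        ; link-symm = imageLink-symm
        ; loopless  = imageLink-loopless
        }

      imageLink-map : ∀ {u v l} → link u v ≡ just l → imageLink (f u) (f v) ≡ just l
      imageLink-map {u} {v} uv with preimage? (f u) (f v)
      ... | yes (u′ , v′ , p , q , e) =
        trans (consistent u′ v′ u v e (subst (T ∘ is-just) (sym uv) _) p q) uv
      ... | no ∄ =
        contradiction (u , v , refl , refl , subst (T ∘ is-just) (sym uv) _) ∄

      toImage : Hom G image
      toImage = record { map-vertex = f ; map-arc = imageLink-map ; map-edge = imageLink-map }

    -- Instead of searching over target graphs, search over the finitely many codes of maps into
    -- `Fin c`: a compatible map yields its own target `image`.
    homToOrder? : Decidable (λ c → Σ[ H ∈ Graph n m ] (Graph.order H ≡ c × Hom G H))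
    homToOrder? c = map′ sound complete (any? λ i → compatible? (finToFun {c} i))
      where
      sound : (∃[ i ] Compatible (finToFun {c} {order} i)) →
              Σ[ H ∈ Graph n m ] (Graph.order H ≡ c × Hom G H)
      sound (i , i-compatible) = image , refl , toImage
        where
        open Image (finToFun i) i-compatible
      complete : Σ[ H ∈ Graph n m ] (Graph.order H ≡ c × Hom G H) →
                 ∃[ i ] Compatible (finToFun {c} {order} i)
      complete (H , refl , f) =
        funToFin map-vertex ,
        compatible-resp-≗ (λ u → sym (finToFun-funToFin map-vertex u)) (hom⇒compatible f)
        where
        open Hom f

    chromaticNumber : ∃ (IsChromaticNumber G)
    chromaticNumber = minimum homToOrder? order
      (G , refl , record { map-vertex = λ u → u ; map-arc = λ e → e ; map-edge = λ e → e })

-- The subdivided complete graph and its two star forests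

module SubdividedComplete (k : ℕ) where

  -- Branch vertices on the left, middle vertices on the right. Diagonal pairs are kept so that the
  -- middle vertices form a plain product.
  V : Set
  V = Fin k ⊎ (Fin k × Fin k)

  size : ℕ
  size = k + k * k

  vertices : Fin size ↔ V
  vertices = ↔-trans +↔⊎ (↔-refl ⊎-↔ *↔×)

  open Inverse vertices public
    using () renaming (to to decode; from to encode; strictlyInverseˡ to decode-encode;
                       strictlyInverseʳ to encode-decode)

  decode-injective : Injective _≡_ _≡_ decode
  decode-injective {u} {v} eq =
    trans (sym (encode-decode u)) (trans (cong encode eq) (encode-decode v))

  -- Colour 0 marks the first end of the path through (i , j), colour 1 the
  -- second; the degenerate vertices (i , i) are pendant.
  incidence : Fin k → Fin k × Fin k → Maybe (Fin 2)
  incidence x (i , j) with x ≟ i | x ≟ j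
  ... | yes _ | _     = just zero
  ... | no _  | yes _ = just (suc zero)
  ... | no _  | no _  = nothing

  incidence-first : ∀ i j → incidence i (i , j) ≡ just zero
  incidence-first i j with i ≟ i | i ≟ j
  ... | yes _  | _ = refl
  ... | no i≢i | _ = contradiction refl i≢i

  incidence-second : ∀ {i j} → i ≢ j → incidence j (i , j) ≡ just (suc zero)
  incidence-second {i} {j} i≢j with j ≟ i | j ≟ j
  ... | yes j≡i | _      = contradiction (sym j≡i) i≢j
  ... | no _    | yes _  = refl
  ... | no _    | no j≢j = contradiction refl j≢j

  end : Fin 2 → Fin k × Fin k → Fin k
  end zero       (i , j) = i
  end (suc zero) (i , j) = j

  incidence⇒end : ∀ {c} x p → incidence x p ≡ just c → x ≡ end c p
  incidence⇒end x (i , j) eq with x ≟ i | x ≟ j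
  incidence⇒end x (i , j) refl | yes x≡i | _       = x≡i
  incidence⇒end x (i , j) refl | no _    | yes x≡j = x≡j

  colour : V → V → Maybe (Fin 2)
  colour (inj₁ x) (inj₂ p) = incidence x p
  colour (inj₂ p) (inj₁ x) = incidence x p
  colour (inj₁ _) (inj₁ _) = nothing
  colour (inj₂ _) (inj₂ _) = nothing

  colour-symm : ∀ a b → colour a b ≡ colour b a
  colour-symm (inj₁ _) (inj₂ _) = refl
  colour-symm (inj₂ _) (inj₁ _) = refl
  colour-symm (inj₁ _) (inj₁ _) = refl
  colour-symm (inj₂ _) (inj₂ _) = refl

  colour-irrefl : ∀ a → colour a a ≡ nothing
  colour-irrefl (inj₁ _) = refl
  colour-irrefl (inj₂ _) = refl

  -- Both neighbours must be the branch vertex `end c p`.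
  colour-functional : ∀ {c} p a b → colour (inj₂ p) a ≡ just c → colour (inj₂ p) b ≡ just c → a ≡ b
  colour-functional p (inj₁ x) (inj₁ y) ea eb =
    cong inj₁ (trans (incidence⇒end x p ea) (sym (incidence⇒end y p eb)))

  hasColour? : ∀ c a b → Dec (colour a b ≡ just c)
  hasColour? c a b = ≡-dec _≟_ (colour a b) (just c)

  stars : Fin 2 → SimpleGraph size
  stars c = record
    { adj    = λ u v → isYes (hasColour? c (decode u) (decode v))
    ; symm   = λ u v → cong (λ z → isYes (≡-dec _≟_ z (just c))) (colour-symm (decode u) (decode v))
    ; irrefl = λ u → cong (λ z → isYes (≡-dec _≟_ z (just c))) (colour-irrefl (decode u))
    }

  stars-leaf : ∀ c u p → decode u ≡ inj₂ p → Leaf (stars c) u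
  stars-leaf c u p u≡p x y ux uy = decode-injective
    (colour-functional p (decode x) (decode y)
      (subst (λ a → colour a (decode x) ≡ just c) u≡p (toWitness ux))
      (subst (λ a → colour a (decode y) ≡ just c) u≡p (toWitness uy)))

  -- Every coloured edge joins a branch vertex to a middle vertex, and the middle vertex is the
  -- leaf.
  stars-leafEnd : ∀ c u v → SimpleGraph.Adj (stars c) u v → Leaf (stars c) u ⊎ Leaf (stars c) v
  stars-leafEnd c u v e = ends (decode u) (decode v) refl refl (toWitness e)
    where
    ends : ∀ a b → decode u ≡ a → decode v ≡ b → colour a b ≡ just c →
           Leaf (stars c) u ⊎ Leaf (stars c) v
    ends (inj₂ p) (inj₁ _) u≡ _  _ = inj₁ (stars-leaf c u p u≡)
    ends (inj₁ _) (inj₂ p) _  v≡ _ = inj₂ (stars-leaf c v p v≡)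

  -- The labelled graph: arboricity and lower bound on the chromatic number

  module _ {n m : ℕ} (label : Fin 2 → Link n m) where

    -- Labels are read from the branch vertex towards the middle vertex, so the two halves of a path
    -- can be compared in the same direction.
    linkᵛ : V → V → Maybe (Link n m)
    linkᵛ (inj₁ x) (inj₂ p) = map label (incidence x p)
    linkᵛ (inj₂ p) (inj₁ x) = map reverse (map label (incidence x p))
    linkᵛ (inj₁ _) (inj₁ _) = nothing
    linkᵛ (inj₂ _) (inj₂ _) = nothing

    reverse-involutive : (l : Link n m) → reverse (reverse l) ≡ l
    reverse-involutive (arcTo _)   = refl
    reverse-involutive (arcFrom _) = refl
    reverse-involutive (edge _)    = refl

    linkᵛ-symm : ∀ a b → linkᵛ b a ≡ map reverse (linkᵛ a b)
    linkᵛ-symm (inj₁ _) (inj₂ _) = refl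
    linkᵛ-symm (inj₂ p) (inj₁ x) with incidence x p
    ... | just c  = cong just (sym (reverse-involutive (label c)))
    ... | nothing = refl
    linkᵛ-symm (inj₁ _) (inj₁ _) = refl
    linkᵛ-symm (inj₂ _) (inj₂ _) = refl

    linkᵛ-loopless : ∀ a → linkᵛ a a ≡ nothing
    linkᵛ-loopless (inj₁ _) = refl
    linkᵛ-loopless (inj₂ _) = refl

    graph : Graph n m
    graph = record
      { order     = size
      ; link      = λ u v → linkᵛ (decode u) (decode v)
      ; link-symm = λ u v → linkᵛ-symm (decode u) (decode v)
      ; loopless  = λ u → linkᵛ-loopless (decode u)
      }

    open SimpleGraph (und graph) using (Adj)

    coloured⇒linked : ∀ {c} a b → colour a b ≡ just c → T (is-just (linkᵛ a b))
    coloured⇒linked (inj₁ x) (inj₂ p) eq rewrite eq = _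
    coloured⇒linked (inj₂ p) (inj₁ x) eq rewrite eq = _

    linked⇒coloured : ∀ a b → T (is-just (linkᵛ a b)) → ∃[ c ] colour a b ≡ just c
    linked⇒coloured (inj₁ x) (inj₂ p) e with incidence x p
    ... | just c = c , refl
    linked⇒coloured (inj₂ p) (inj₁ x) e with incidence x p
    ... | just c = c , refl

    starDecomposition : ForestDecomposition (und graph) 2
    starDecomposition = record
      { part     = stars
      ; forest   = λ c → leaf-edges⇒forest (stars c) (stars-leafEnd c)
      ; within   = λ c {u} {v} e → coloured⇒linked (decode u) (decode v) (toWitness e)
      ; covers   = λ {u} {v} e → let c , eq = linked⇒coloured (decode u) (decode v) e in
                                 c , fromWitness eq
      -- An edge has only one colour, as `colour` is a function.
      ; disjoint = λ e e′ → just-injective (trans (sym (toWitness e)) (toWitness e′))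
      }

    encode-adj : ∀ {c} a b → colour a b ≡ just c → Adj (encode a) (encode b)
    encode-adj a b eq = subst₂ (λ a′ b′ → T (is-just (linkᵛ a′ b′)))
      (sym (decode-encode a)) (sym (decode-encode b)) (coloured⇒linked a b eq)

    fourCycle : ∀ {x y} → x ≢ y → Cycle (und graph)
    fourCycle {x} {y} x≢y = record
      { vertex   = encode ∘ corner
      ; distinct = λ {i} {j} eq → corner-injective i j
          (trans (sym (decode-encode (corner i))) (trans (cong decode eq) (decode-encode (corner j))))
      ; step     = λ
          { zero             → encode-adj (corner (# 0)) (corner (# 1)) (incidence-first x y)
          ; (suc zero)       → encode-adj (corner (# 1)) (corner (# 2)) (incidence-second x≢y)
          ; (suc (suc zero)) → encode-adj (corner (# 2)) (corner (# 3)) (incidence-first y x)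
          }
      ; closing  = encode-adj (corner (# 3)) (corner (# 0)) (incidence-second (x≢y ∘ sym))
      }
      where
      corner : Fin 4 → V
      corner zero                   = inj₁ x
      corner (suc zero)             = inj₂ (x , y)
      corner (suc (suc zero))       = inj₁ y
      corner (suc (suc (suc zero))) = inj₂ (y , x)
      corner-injective : ∀ i j → corner i ≡ corner j → i ≡ j
      corner-injective zero zero _ = refl
      corner-injective zero (suc (suc zero)) refl = contradiction refl x≢y
      corner-injective zero (suc (suc (suc zero))) ()
      corner-injective (suc zero) (suc zero) _ = refl
      corner-injective (suc zero) (suc (suc (suc zero))) refl = contradiction refl x≢y
      corner-injective (suc (suc zero)) zero refl = contradiction refl x≢y
      corner-injective (suc (suc zero)) (suc (suc zero)) _ = refl
      corner-injective (suc (suc zero)) (suc (suc (suc zero))) ()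
      corner-injective (suc (suc (suc zero))) (suc zero) refl = contradiction refl x≢y
      corner-injective (suc (suc (suc zero))) (suc (suc (suc zero))) _ = refl

    arboricity-2 : ∀ {x y : Fin k} → x ≢ y → IsArboricity (und graph) 2
    arboricity-2 x≢y = record
      { attained = starDecomposition
      ; least    = cycle⇒2≤forests (und graph) (fourCycle x≢y)
      }

    encode-link : ∀ x p {c} → incidence x p ≡ just c →
                  Graph.link graph (encode (inj₁ x)) (encode (inj₂ p)) ≡ just (label c)
    encode-link x p eq =
      trans (cong₂ linkᵛ (decode-encode (inj₁ x)) (decode-encode (inj₂ p))) (cong (map label) eq)

    hom-injective-on-branch : label zero ≢ label (suc zero) → ∀ {H} (f : Hom graph H) →
                              Injective _≡_ _≡_ (Hom.map-vertex f ∘ encode ∘ inj₁)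
    hom-injective-on-branch distinctLabels {H} f {x} {y} fx≡fy with x ≟ y
    ... | yes x≡y = x≡y
    ... | no x≢y = contradiction (just-injective sameLabel) distinctLabels
      where
      sameLabel : just (label zero) ≡ just (label (suc zero))
      sameLabel =
        trans (sym (map-link f (encode-link x (x , y) (incidence-first x y))))
              -- Both halves of the path through `(x , y)` land on the same pair of `H`, which
              -- carries a single link.
              (trans (cong (λ a → Graph.link H a (Hom.map-vertex f (encode (inj₂ (x , y))))) fx≡fy)
                     (map-link f (encode-link y (x , y) (incidence-second x≢y))))

    k≤chromaticNumber : label zero ≢ label (suc zero) →
                        ∀ {c} → IsChromaticNumber graph c → k ≤ c
    k≤chromaticNumber distinctLabels χ with IsMinimum.attained χ
    ... | H , refl , f = injective⇒≤ (hom-injective-on-branch distinctLabels f)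

-- Choice of the two links, and the theorem

distinctLinks : ∀ n m → 1 ≤ 2 * n + m → (n , m) ≢ (0 , 1) →
                Σ[ label ∈ (Fin 2 → Link n m) ] label zero ≢ label (suc zero)
-- One arc type suffices: its two directions make each subdivided path a directed path.
distinctLinks (suc n) m _ _ = (λ { zero → arcTo zero ; (suc _) → arcFrom zero }) , λ ()
distinctLinks zero (suc zero) _ ≢01 = contradiction refl ≢01
distinctLinks zero (suc (suc m)) _ _ = (λ { zero → edge zero ; (suc _) → edge (suc zero) }) , λ ()

theorem2p1 : ∀ (n m : ℕ) → 1 ≤ 2 * n + m → (n , m) ≢ (0 , 1) →
    ∀ (k r : ℕ) → 2 ≤ k → 2 ≤ r →
    Σ[ G ∈ Graph n m ]
    ( (∃[ a ] (IsArboricity (und G) a × a ≤ r))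
    × (∃[ c ] (IsChromaticNumber G c × k ≤ c)) )
theorem2p1 n m 1≤ ≢01 k@(suc (suc _)) r (s≤s (s≤s _)) 2≤r =
  let label , distinctLabels = distinctLinks n m 1≤ ≢01
      c , χ = chromaticNumber (graph label)
  in graph label
   -- As `k` is at least 2, `zero` and `suc zero` are two distinct branch vertices to carry the
   -- 4-cycle.
   , (2 , arboricity-2 label {zero} {suc zero} (λ ()) , 2≤r)
   , (c , χ , k≤chromaticNumber label distinctLabels χ)
  where
  open SubdividedComplete k
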